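{- Over a $4$-letter alphabet there is no complete bifurcate tree; more precisely, there is no complete bifurcate tree over a $4$-letter alphabet containing words of length more than $6$ (and since every complete bifurcate tree contains arbitrarily long words, none exists at all).
   Context: A square is a nonempty word of the form $XX$; a word is square-free if it has no (contiguous) factor that is a square. For a word $W$ of length $n$ and $0\le i\le n$, let $P_i(W)$, $S_i(W)$ be the prefix and suffix of $W$ of length $i$; an extension of $W$ at position $i$ over alphabet $\mathcal{A}$ is a word $P_i(W)\mathtt{x}S_{n-i}(W)$ with $\mathtt{x}\in\mathcal{A}$. A square-free word of length $n$ is bifurcate over $\mathcal{A}$ if for each position $i\in\{0,\dots,n\}$ it has a square-free extension at position $i$. A bifurcate tree over $\mathcal{A}$ is a family of bifurcate words over $\mathcal{A}$ arranged as a rooted tree in which the children of a word $W$ are single-letter extensions of $W$ at pairwise different positions. It is complete if every word of length $n$ in it has exactly $n+1$ children (one extension at each position $0,\dots,n$). -}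

module Defs where

open import Data.Fin using (Fin; toℕ)
open import Data.List using (List; []; _∷_; _++_; length; take; drop)
open import Data.Nat using (ℕ; suc; _<_)
open import Data.Product using (Σ; ∃; ∃-syntax; _×_; _,_)
open import Function.Definitions using (Injective; Bijective)
open import Relation.Binary.Construct.Closure.ReflexiveTransitive using (Star)
open import Relation.Binary.PropositionalEquality using (_≡_; _≢_)
open import Relation.Nullary using (¬_)

Word : Set → Set
Word A = List A

module _ {A : Set} where

  Square : Word A → Set
  Square U = ∃[ X ] (X ≢ [] × U ≡ X ++ X)

  Factor : Word A → Word A → Set
  Factor U W = ∃[ P ] ∃[ S ] (W ≡ P ++ U ++ S)

  SquareFree : Word A → Set
  SquareFree W = ¬ (∃[ U ] (Factor U W × Square U))

  Position : Word A → Set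
  Position W = Fin (suc (length W))

  -- For i ≤ length W, the suffix of W of length (length W ∸ i) is drop i W.
  extend : (W : Word A) → Position W → A → Word A
  extend W i x = take (toℕ i) W ++ x ∷ drop (toℕ i) W

  IsExtensionAt : (W : Word A) → Position W → Word A → Set
  IsExtensionAt W i V = ∃[ x ] (V ≡ extend W i x)

  Bifurcate : Word A → Set
  Bifurcate W = SquareFree W
              × (∀ (i : Position W) → ∃[ V ] (IsExtensionAt W i V × SquareFree V))

-- The words form a family indexed by the nodes, so one word may label several
-- nodes, and the root may carry any word.
record BifurcateTree (A : Set) : Set₁ where
  field
    Node  : Set
    Child : Node → Node → Set   -- Child u v : v is a child of u
    root  : Node

    -- Rooted tree: exactly one directed path from the root to each node.
    uniquePath : ∀ v → Σ (Star Child root v) λ p → ∀ q → q ≡ p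

    word      : Node → Word A
    bifurcate : ∀ v → Bifurcate (word v)

  Children : Node → Set
  Children u = ∃[ v ] Child u v

  field
    position  : ∀ u → Children u → Position (word u)
    extension : ∀ u (c@(v , _) : Children u) → IsExtensionAt (word u) (position u c) (word v)
    distinct  : ∀ u → Injective _≡_ _≡_ (position u)

  -- A word of length n has n + 1 positions, so a bijection between children and
  -- positions says that there are exactly n + 1 children, one at each position.
  FullyBranching : Node → Set
  FullyBranching u = Bijective _≡_ _≡_ (position u)

  Complete : Set
  Complete = ∀ u → FullyBranching u

  -- Completeness required only of the words of length less than m, i.e.
  -- completeness of a tree that may be cut off at the words of length m.
  CompleteBelow : ℕ → Set
  CompleteBelow m = ∀ u → length (word u) < m → FullyBranching u

open BifurcateTree public using (Node; root; word; Complete; CompleteBelow)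

{-# OPTIONS --safe #-}

-- Think of the tree as a game: an adversary chooses the position at which the
-- current word is to be extended, and the tree answers with a letter.  Over four
-- letters the adversary forces a square within six moves, starting from any
-- single letter.  Up to renaming letters (and reversal), the adversary can play
-- so that the only square-free lines of the game are a, ab, abc, then abcb or
-- abcd, then abcdc or abacd, then abacdc; and every letter inserted in the middle
-- of abacdc creates a square.  A tree whose root is a longer word W loses the same
-- game played to the right of W, because factors of square-free words are
-- square-free.

module Submission where

open import Defs
open import Data.Empty using (⊥)
open import Data.Fin using (Fin; zero; suc; toℕ; fromℕ<)
open import Data.Fin.Properties using (_≟_; all?; any?; toℕ-fromℕ<)
open import Data.List using (List; []; _∷_; _++_; length; map; take; drop)
open import Data.List.Properties using (≡-dec; ++-assoc; ++-identityʳ; length-++; map-++; take++drop≡id)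
open import Data.Nat using (ℕ; zero; suc; _+_; _≤_; _<_; z≤n; s≤s)
open import Data.Nat.Properties using (≤-trans; ≤-reflexive; m≤m+n; m≤n+m; +-suc)
open import Data.Product using (Σ; ∃-syntax; _×_; _,_; proj₁)
open import Data.Sum using (_⊎_; inj₁; inj₂)
open import Function.Base using (_∘_)
open import Function.Bundles using (_↔_; Inverse)
open import Relation.Binary.PropositionalEquality using (_≡_; refl; sym; trans; cong; subst; module ≡-Reasoning)
open import Relation.Nullary using (¬_; Dec; no)
open import Relation.Nullary.Decidable using (_⊎-dec_; from-yes; map′)

private
  variable
    A B : Set

squareFree-factor : ∀ {W : Word A} P V S → W ≡ P ++ V ++ S → SquareFree W → SquareFree V
squareFree-factor P V S refl sf (U , (P′ , S′ , refl) , square) =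
  sf (U , (P ++ P′ , S′ ++ S , eq) , square)
  where
  eq : P ++ (P′ ++ U ++ S′) ++ S ≡ (P ++ P′) ++ U ++ S′ ++ S
  eq = begin
    P ++ (P′ ++ U ++ S′) ++ S  ≡⟨ cong (P ++_) (++-assoc P′ (U ++ S′) S) ⟩
    P ++ P′ ++ (U ++ S′) ++ S  ≡⟨ cong (λ Z → P ++ P′ ++ Z) (++-assoc U S′ S) ⟩
    P ++ P′ ++ U ++ S′ ++ S    ≡⟨ ++-assoc P P′ (U ++ S′ ++ S) ⟨
    (P ++ P′) ++ U ++ S′ ++ S  ∎
    where open ≡-Reasoning

-- Letterwise maps send squares to squares. With `f` the renaming from `Fin 4`, squares found by the
-- search reappear in words over `A`.
squareFree-map⁻ : ∀ (f : A → B) {W} → SquareFree (map f W) → SquareFree W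
squareFree-map⁻ f sf (_ , (P , S , refl) , [] , X≢[] , _) with () ← X≢[] refl
squareFree-map⁻ f sf (_ , (P , S , refl) , X@(_ ∷ _) , _ , refl) =
  sf (map f (X ++ X) , (map f P , map f S , eq) , map f X , (λ ()) , map-++ f X X)
  where
  eq : map f (P ++ (X ++ X) ++ S) ≡ map f P ++ map f (X ++ X) ++ map f S
  eq = trans (map-++ f P ((X ++ X) ++ S)) (cong (map f P ++_) (map-++ f (X ++ X) S))

-- A finite search over the start of the square and its half-length `suc (toℕ l)`. Too large a
-- half-length does no harm: the right-hand `take` is then truncated and cannot equal the left one.
HasSquare : Word A → Set
HasSquare []        = ⊥
HasSquare V@(_ ∷ W) =
  (∃[ l ] take (suc (toℕ l)) V ≡ take (suc (toℕ {length W} l)) (drop (suc (toℕ l)) V)) ⊎ HasSquare W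

hasSquare⇒¬squareFree : ∀ (W : Word A) → HasSquare W → ¬ SquareFree W
hasSquare⇒¬squareFree V@(x ∷ W) (inj₁ (l , repeat)) sf =
  sf (X ++ X , ([] , drop n (drop n V) , eq) , X , (λ ()) , refl)
  where
  n = suc (toℕ l)
  X = take n V
  eq : V ≡ (X ++ X) ++ drop n (drop n V)
  eq = begin
    V                                            ≡⟨ take++drop≡id n V ⟨
    X ++ drop n V                                ≡⟨ cong (X ++_) (take++drop≡id n (drop n V)) ⟨
    X ++ take n (drop n V) ++ drop n (drop n V)  ≡⟨ cong (λ Y → X ++ Y ++ drop n (drop n V)) repeat ⟨
    X ++ X ++ drop n (drop n V)                  ≡⟨ ++-assoc X X _ ⟨
    (X ++ X) ++ drop n (drop n V)                ∎
    where open ≡-Reasoning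
hasSquare⇒¬squareFree (x ∷ W) (inj₂ p) sf =
  hasSquare⇒¬squareFree W p
    (squareFree-factor (x ∷ []) W [] (cong (x ∷_) (sym (++-identityʳ W))) sf)

hasSquare? : ∀ {n} (W : Word (Fin n)) → Dec (HasSquare W)
hasSquare? []      = no λ ()
hasSquare? (_ ∷ W) = any? (λ _ → ≡-dec _≟_ _ _) ⊎-dec hasSquare? W

-- The side that loses is the tree, and `k` bounds the number of moves left to the adversary.
Losing : ℕ → Word A → Set
Losing     zero    W = ⊥
Losing {A} (suc k) W =
  ∃[ i ] (∀ (x : A) → HasSquare (extend W i x) ⊎ Losing k (extend W i x))

-- Trying the leftmost position last makes the search several times shorter.
losing? : ∀ {n} k (W : Word (Fin n)) → Dec (Losing k W)
losing? zero    W = no λ ()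
losing? (suc k) W = map′
  (λ { (inj₁ (i , p)) → suc i , p ; (inj₂ p) → zero , p })
  (λ { (zero , p) → inj₂ p ; (suc i , p) → inj₁ (i , p) })
  (any? (λ i → winningMove? (suc i)) ⊎-dec winningMove? zero)
  where
  winningMove? : ∀ i → Dec (∀ x → HasSquare (extend W i x) ⊎ Losing k (extend W i x))
  winningMove? i = all? λ x → hasSquare? (extend W i x) ⊎-dec losing? k (extend W i x)

-- Settled by evaluating the exhaustive search during type checking. The sixth move would produce a
-- word of length 7, whence the bound in the theorem.
letter-losing : ∀ (x : Fin 4) → Losing 6 (x ∷ [])
letter-losing = from-yes (all? λ (x : Fin 4) → losing? 6 (x ∷ []))

[]-losing : Losing {Fin 4} 7 []
[]-losing = zero , inj₂ ∘ letter-losing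

take-length-++ : ∀ (P S : List A) → take (length P) (P ++ S) ≡ P
take-length-++ []      S = refl
take-length-++ (x ∷ P) S = cong (x ∷_) (take-length-++ P S)

drop-length-++ : ∀ (P S : List A) → drop (length P) (P ++ S) ≡ S
drop-length-++ []      S = refl
drop-length-++ (x ∷ P) S = drop-length-++ P S

-- Lets a position be given as a splitting, so that a move inside a factor carries over to the whole
-- word without index arithmetic.
extend-++ : ∀ {W : Word A} P S → W ≡ P ++ S → ∃[ i ] (∀ x → extend W i x ≡ P ++ x ∷ S)
extend-++ P S refl = fromℕ< |P|<1+|P++S| , extend≡
  where
  |P|<1+|P++S| : length P < suc (length (P ++ S))
  |P|<1+|P++S| = s≤s (≤-trans (m≤m+n (length P) (length S)) (≤-reflexive (sym (length-++ P))))
  extend≡ : ∀ x → extend (P ++ S) (fromℕ< |P|<1+|P++S|) x ≡ P ++ x ∷ S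
  extend≡ x rewrite toℕ-fromℕ< |P|<1+|P++S| | take-length-++ P S | drop-length-++ P S = refl

length-insert : ∀ (P : List A) {S} x → length (P ++ x ∷ S) ≡ suc (length (P ++ S))
length-insert []      x = refl
length-insert (_ ∷ P) x = cong suc (length-insert P x)

module _ (T : BifurcateTree A) where
  open BifurcateTree T using (FullyBranching)

  child-inserting : ∀ {u} P S → FullyBranching u → word T u ≡ P ++ S →
                    ∃[ v ] ∃[ x ] (word T v ≡ P ++ x ∷ S)
  child-inserting {u} P S (_ , surjective) W≡PS with extend-++ P S W≡PS
  ... | i , extend≡ with surjective i
  ...   | c@(v , _) , position≡ with BifurcateTree.extension T u c
  ...     | x , eq rewrite position≡ refl = v , x , trans eq (extend≡ x)

  -- Induction on `k`: the game is played inside the right-hand factor `V`, and `P` never changes.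
  -- Each move trades one unit of `k` for one letter, so the completeness bound stays the same
  -- number throughout.
  losing-unreachable : ∀ (A↔Fin4 : A ↔ Fin 4) k {v} P V → CompleteBelow T (k + length (word T v)) →
                       word T v ≡ P ++ map (Inverse.from A↔Fin4) V → ¬ Losing k V
  losing-unreachable A↔Fin4 (suc k) {u} P V complete W≡PV (i , losing) =
    impossible-child (child-inserting (P ++ map from V₁) (map from V₂)
                 (complete u (s≤s (m≤n+m _ k))) W≡)
    where
    open Inverse A↔Fin4 using (to; from; strictlyInverseʳ)
    V₁ = take (toℕ i) V
    V₂ = drop (toℕ i) V

    W≡ : word T u ≡ (P ++ map from V₁) ++ map from V₂
    W≡ = begin
      word T u                           ≡⟨ W≡PV ⟩
      P ++ map from V                    ≡⟨ cong (λ Z → P ++ map from Z) (take++drop≡id (toℕ i) V) ⟨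
      P ++ map from (V₁ ++ V₂)           ≡⟨ cong (P ++_) (map-++ from V₁ V₂) ⟩
      P ++ map from V₁ ++ map from V₂    ≡⟨ ++-assoc P _ _ ⟨
      (P ++ map from V₁) ++ map from V₂  ∎
      where open ≡-Reasoning

    word≡ : ∀ {v x} → word T v ≡ (P ++ map from V₁) ++ x ∷ map from V₂ →
            word T v ≡ P ++ map from (extend V i (to x))
    word≡ {v} {x} eq = begin
      word T v                                       ≡⟨ eq ⟩
      (P ++ map from V₁) ++ x ∷ map from V₂          ≡⟨ ++-assoc P _ _ ⟩
      P ++ map from V₁ ++ x ∷ map from V₂            ≡⟨ cong (λ y → P ++ map from V₁ ++ y ∷ map from V₂) (strictlyInverseʳ x) ⟨
      P ++ map from V₁ ++ from (to x) ∷ map from V₂  ≡⟨ cong (P ++_) (map-++ from V₁ (to x ∷ V₂)) ⟨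
      P ++ map from (extend V i (to x))              ∎
      where open ≡-Reasoning

    length≡ : ∀ {v x} → word T v ≡ (P ++ map from V₁) ++ x ∷ map from V₂ →
              suc k + length (word T u) ≡ k + length (word T v)
    length≡ {v} {x} eq = begin
      suc (k + length (word T u))                                ≡⟨ +-suc k _ ⟨
      k + suc (length (word T u))                                ≡⟨ cong (λ W → k + suc (length W)) W≡ ⟩
      k + suc (length ((P ++ map from V₁) ++ map from V₂))       ≡⟨ cong (k +_) (length-insert (P ++ map from V₁) x) ⟨
      k + length ((P ++ map from V₁) ++ x ∷ map from V₂)         ≡⟨ cong (λ W → k + length W) eq ⟨
      k + length (word T v)                                      ∎
      where open ≡-Reasoning

    impossible-child : ¬ (∃[ v ] ∃[ x ] (word T v ≡ (P ++ map from V₁) ++ x ∷ map from V₂))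
    impossible-child (v , x , eq) with losing (to x)
    -- The tree's word is square-free, hence so is its factor to the right of `P`, hence so is the
    -- preimage of that factor over `Fin 4`.
    ... | inj₁ square = hasSquare⇒¬squareFree _ square
            (squareFree-map⁻ from
              (squareFree-factor P _ []
                (trans (word≡ eq) (cong (P ++_) (sym (++-identityʳ _))))
                (proj₁ (BifurcateTree.bifurcate T v))))
    ... | inj₂ losing′ = losing-unreachable A↔Fin4 k P _
            (subst (CompleteBelow T) (length≡ eq) complete) (word≡ eq) losing′

  complete⇒longWords : Complete T → ∀ m → ∃[ v ] (m ≤ length (word T v))
  complete⇒longWords complete zero = root T , z≤n
  complete⇒longWords complete (suc m) with complete⇒longWords complete m
  -- Prepending a letter serves here because the splitting with an empty left part holds by `refl`.
  ... | u , m≤|W| with child-inserting [] (word T u) (complete u) refl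
  ...   | v , x , eq = v , ≤-trans (s≤s m≤|W|) (≤-reflexive (sym (cong length eq)))

  ¬complete : A ↔ Fin 4 → ¬ Complete T
  -- The game starts from the empty factor at the right end of the root's word, whatever that word
  -- is.
  ¬complete A↔Fin4 complete = losing-unreachable A↔Fin4 7 {root T} (word T (root T)) []
    (λ u _ → complete u) (sym (++-identityʳ _)) []-losing

  -- Both starting words fit the bound exactly: seven moves from length 0, six from length 1.
  ¬completeBelow7 : A ↔ Fin 4 → length (word T (root T)) ≤ 1 → ¬ CompleteBelow T 7
  ¬completeBelow7 A↔Fin4 |root|≤1 complete with word T (root T) in eq
  ... | [] = losing-unreachable A↔Fin4 7 {root T} [] []
    (subst (λ W → CompleteBelow T (7 + length W)) (sym eq) complete) eq []-losing
  ... | a ∷ [] = losing-unreachable A↔Fin4 6 {root T} [] (to a ∷ [])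
    (subst (λ W → CompleteBelow T (6 + length W)) (sym eq) complete)
    (trans eq (cong (_∷ []) (sym (strictlyInverseʳ a)))) (letter-losing (to a))
    where open Inverse A↔Fin4 using (to; strictlyInverseʳ)
  ¬completeBelow7 _ (s≤s ()) _ | _ ∷ _ ∷ _

mainTheorem7 : (A : Set) → A ↔ Fin 4 →
    -- no complete bifurcate tree over A
    (¬ (Σ (BifurcateTree A) λ T → Complete T))
    -- no complete bifurcate tree over A containing words of length more than 6
  × (¬ (Σ (BifurcateTree A) λ T → Complete T × (∃[ v ] (6 < length (word T v)))))
    -- the same for trees cut off at length 7, grown from the empty word or a letter
  × (¬ (Σ (BifurcateTree A) λ T → length (word T (root T)) ≤ 1 × CompleteBelow T 7 × (∃[ v ] (6 < length (word T v)))))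
    -- over any alphabet, complete bifurcate trees contain arbitrarily long words
  × ((B : Set) (T : BifurcateTree B) → Complete T → (m : ℕ) → ∃[ v ] (m ≤ length (word T v)))
mainTheorem7 A A↔Fin4 =
    (λ (T , complete) → ¬complete T A↔Fin4 complete)
  , (λ (T , complete , _) → ¬complete T A↔Fin4 complete)
  , (λ (T , |root|≤1 , complete , _) → ¬completeBelow7 T A↔Fin4 |root|≤1 complete)
  , λ _ → complete⇒longWords
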